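{- Let $G$ be a finite Abelian group, $H\subset G$ a subgroup such that $G/H$ is cyclic, and $\rho\in G$ an element whose image in $G/H$ is a generator. Let $\Phi_\rho:\mathcal{C}(H)\to\mathcal{C}(G)$ be the monoscopic embedding along $\rho$ and $\vec s$ its beta ray. For any face $F\subset\mathcal{C}(H)$, the set $\mathbb{R}_{\ge 0}\vec s+\Phi_\rho(F)$ is a face of $\mathcal{C}(G)$ whose Kunz poset is the monoscopic extension along $\rho$ of the Kunz poset of $F$.
   Context: Group cone: for a finite Abelian group $G$ with $|G|=m$, the group cone $\mathcal{C}(G)\subset\mathbb{R}^{m-1}_{\ge 0}$ (coordinates indexed by $G\setminus\{0\}$) is the pointed cone of all points with non-negative coordinates satisfying $x_i+x_j\ge x_{i+j}$ for all $i,j\in G\setminus\{0\}$ with $i+j\ne 0$. (Non-negativity is implied by the other inequalities when $|G|\ge 3$.) By convention each point of $\mathcal{C}(G)$ is also given a coordinate $x_0=0$ indexed by the identity. Kunz subgroup and Kunz poset: for a face $F\subset\mathcal{C}(G)$, the set $K=\{g\in G: x_g=0\text{ for all }x\in F\}$ is a subgroup of $G$, called the Kunz subgroup of $F$; the Kunz poset of $F$ is the partial order on $G/K$ with unique minimal element $\overline 0$ and $\overline a\preceq\overline b$ whenever $x_a+x_{b-a}=x_b$ for all $x\in F$ ($a,b\in G$ distinct). This is known to be well defined. Monoscopic embedding: let $\beta=|G/H|$. Define $\Phi_\rho:\mathcal{C}(H)\to\mathcal{C}(G)$, $w\mapsto x$, by $x_{a+b\rho}=\beta w_a+b\,w_{\beta\rho}$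 for each $a\in H$ and each integer $0\le b<\beta$ (here $\beta\rho\in H$, and $w_0=0$). Beta ray: the vector $\vec s$ defined by $s_{a+b\rho}=b$ for each $a\in H$ and $0\le b\le\beta-1$. Monoscopic extension: let $P=(H/H',\preceq_P)$ be a poset, with $H'\subset H$ a subgroup. Every element of $G/H'$ is uniquely $a+b\rho$ with $a\in H/H'$, $0\le b\le\beta-1$. The monoscopic extension of $P$ along $\rho$ is the poset $Q=(G/H',\preceq_Q)$ with $a+b\rho\preceq_Q a'+b'\rho$ (for $a,a'\in H/H'$, $0\le b,b'\le\beta-1$) exactly when $a\preceq_P a'$ and $b\le b'$. -}

module Defs where

open import Algebra.Bundles using (AbelianGroup; CommutativeRing)
open import Algebra.Apartness.Bundles using (HeytingField; HeytingCommutativeRing)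
open import Algebra.Module.Bundles using (LeftModule)
import Algebra.Module.Construct.TensorUnit as TensorUnit
open import Algebra.Module.Morphism.Structures using (IsLeftModuleHomomorphism)
import Algebra.Properties.AbelianGroup as AbelianGroupProperties
import Algebra.Properties.CommutativeMonoid.Mult as Mult
import Algebra.Properties.CommutativeSemigroup as CommutativeSemigroupProperties
open import Data.Empty using (⊥; ⊥-elim)
open import Data.Fin.Base as Fin using (Fin; toℕ; fromℕ<)
import Data.Fin.Properties as Fin
open import Data.Integer.Base as ℤ using (ℤ)
open import Data.Nat.Base as ℕ using (ℕ; zero; suc; _%_)
import Data.Nat.DivMod as ℕ
import Data.Nat.Properties as ℕ
open import Data.Product.Base using (Σ; ∃; ∃₂; _×_; _,_; proj₁; proj₂)
open import Data.Sum.Base using (_⊎_; inj₁; inj₂)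
open import Function.Bundles using (Inverse)
open import Level using (Level; _⊔_) renaming (suc to lsuc)
open import Relation.Binary.Bundles using (Poset)
open import Relation.Binary.Core using (Rel; _⇔_)
open import Relation.Binary.Definitions using (_Respects_; tri<; tri≈; tri>)
open import Relation.Binary.PropositionalEquality as ≡ using (_≡_)
import Relation.Binary.Reasoning.PartialOrder
import Relation.Binary.Reasoning.Setoid
open import Relation.Binary.Structures
  using (IsStrictPartialOrder; IsPartialOrder)
open import Relation.Nullary.Negation using (¬_)
open import Relation.Unary using (Pred; _⊆_; _≐_; _∩_)

private
  variable
    g ℓ p q r : Level

------------------------------------------------------------------------
-- Real numbers

-- The reals as a Cauchy complete Archimedean ordered field.  Classically
-- this determines ℝ up to unique isomorphism; the formulation with a Heyting
-- field (x # y iff x < y or y < x, and x ≤ y defined as ¬ (y < x)) makes the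
-- constructive real numbers a model as well.

record Reals c ℓ₁ ℓ₂ ℓ₃ : Set (lsuc (c ⊔ ℓ₁ ⊔ ℓ₂ ⊔ ℓ₃)) where
  field
    heytingField : HeytingField c ℓ₁ ℓ₂

  open HeytingField heytingField public
    using (_#_; #⇒invertible; invertible⇒#; #-irrefl; #-sym; #-cotrans; tight; heytingCommutativeRing)

  open CommutativeRing (HeytingCommutativeRing.commutativeRing heytingCommutativeRing) public

  open Mult +-commutativeMonoid public
    using () renaming (_×_ to infixr 8 _·_)

  infix 4 _<_ _≤_

  field
    _<_                    : Rel Carrier ℓ₃
    <-isStrictPartialOrder : IsStrictPartialOrder _≈_ _<_
    #⇒<⊎>                  : ∀ {x y} → x # y → x < y ⊎ y < x
    <⇒#                    : ∀ {x y} → x < y → x # y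
    +-monoˡ-<              : ∀ z {x y} → x < y → x + z < y + z
    *-pos                  : ∀ {x y} → 0# < x → 0# < y → 0# < x * y
    archimedean            : ∀ x → ∃ λ n → x < n · 1#
    complete               :
      (u : ℕ → Carrier) →
      (∀ ε → 0# < ε → ∃ λ N → ∀ m n → N ℕ.≤ m → N ℕ.≤ n → u m - u n < ε) →
      ∃ λ l → ∀ ε → 0# < ε → ∃ λ N → ∀ n → N ℕ.≤ n →
        (u n - l < ε) × (l - u n < ε)

  _≤_ : Rel Carrier ℓ₃
  x ≤ y = ¬ (y < x)

  open IsStrictPartialOrder <-isStrictPartialOrder public
    using (<-respʳ-≈; <-respˡ-≈)
    renaming (irrefl to <-irrefl; trans to <-trans)

  <-cotrans : ∀ {x y} → x < y → ∀ z → x < z ⊎ z < y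
  <-cotrans x<y z with #-cotrans (<⇒# x<y) z
  ... | inj₁ x#z with #⇒<⊎> x#z
  ...   | inj₁ x<z = inj₁ x<z
  ...   | inj₂ z<x = inj₂ (<-trans z<x x<y)
  <-cotrans x<y z | inj₂ z#y with #⇒<⊎> z#y
  ...   | inj₁ z<y = inj₂ z<y
  ...   | inj₂ y<z = inj₁ (<-trans x<y y<z)

  ≤-isPartialOrder : IsPartialOrder _≈_ _≤_
  ≤-isPartialOrder = record
    { isPreorder = record
      { isEquivalence = isEquivalence
      ; reflexive     = λ x≈y y<x → <-irrefl (sym x≈y) y<x
      ; trans         = λ {i} {j} {k} i≤j j≤k k<i → neither (<-cotrans k<i j) i≤j j≤k
      }
    ; antisym = λ x≤y y≤x → proj₁ (tight _ _) λ x#y → neither (#⇒<⊎> x#y) x≤y y≤x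
    }
    where
    neither : {A B : Set ℓ₃} → A ⊎ B → ¬ B → ¬ A → ⊥
    neither (inj₁ a) ¬b ¬a = ¬a a
    neither (inj₂ b) ¬b ¬a = ¬b b

  ≤-poset : Poset c ℓ₁ ℓ₃
  ≤-poset = record { isPartialOrder = ≤-isPartialOrder }

  open Poset ≤-poset public
    using ()
    renaming (refl to ≤-refl; reflexive to ≤-reflexive; trans to ≤-trans; antisym to ≤-antisym)

  +-monoˡ-≤ : ∀ z {x y} → x ≤ y → x + z ≤ y + z
  +-monoˡ-≤ z x≤y lt =
    x≤y (<-respˡ-≈ (cancel _) (<-respʳ-≈ (cancel _) (+-monoˡ-< (- z) lt)))
    where
    cancel : ∀ a → a + z + - z ≈ a
    cancel a = trans (+-assoc a z (- z)) (trans (+-congˡ (-‿inverseʳ z)) (+-identityʳ a))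

  +-mono-≤ : ∀ {x y u v} → x ≤ y → u ≤ v → x + u ≤ y + v
  +-mono-≤ {x} {y} {u} {v} x≤y u≤v = ≤-trans (+-monoˡ-≤ u x≤y)
    (≤-trans (≤-reflexive (+-comm y u)) (≤-trans (+-monoˡ-≤ y u≤v) (≤-reflexive (+-comm v y))))

------------------------------------------------------------------------
-- Abelian groups

module _ (G : AbelianGroup g ℓ) where
  open AbelianGroup G
  open Mult commutativeMonoid using () renaming (_×_ to _·_)

  HasOrder : ℕ → Set (g ⊔ ℓ)
  HasOrder m = Inverse setoid (≡.setoid (Fin m))

  infixr 8 _·ℤ_

  _·ℤ_ : ℤ → Carrier → Carrier
  (ℤ.+ n)    ·ℤ x = n · x
  ℤ.-[1+ n ] ·ℤ x = (suc n · x) ⁻¹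

  IsGenerator : Pred Carrier (g ⊔ ℓ)
  IsGenerator ρ = ∀ x → ∃ λ k → x ≈ k ·ℤ ρ

  -- A consequence of finiteness that, unlike finiteness itself, is inherited
  -- by subgroups without deciding membership.
  Torsion : Set (g ⊔ ℓ)
  Torsion = ∀ x → ∃ λ n → x ⁻¹ ≈ n · x

  record Subgroup p : Set (g ⊔ ℓ ⊔ lsuc p) where
    field
      member    : Pred Carrier p
      resp      : member Respects _≈_
      ε-closed  : member ε
      ∙-closed  : ∀ {x y} → member x → member y → member (x ∙ y)
      ⁻¹-closed : ∀ {x} → member x → member (x ⁻¹)

    ·-closed : ∀ n {x} → member x → member (n · x)
    ·-closed zero    x∈ = ε-closed
    ·-closed (suc n) x∈ = ∙-closed x∈ (·-closed n x∈)

open Subgroup using (member)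

module _ {G : AbelianGroup g ℓ} where
  open AbelianGroup G
  open AbelianGroupProperties G
  open CommutativeSemigroupProperties commutativeSemigroup using (interchange)
  open Mult commutativeMonoid using () renaming (_×_ to _·_)
  open Relation.Binary.Reasoning.Setoid setoid

  -- The subgroup as a group in its own right.
  ⟨_⟩ : Subgroup G p → AbelianGroup (g ⊔ p) ℓ
  ⟨ H ⟩ = record
    { Carrier = Σ Carrier (member H)
    ; _≈_     = λ x y → proj₁ x ≈ proj₁ y
    ; _∙_     = λ x y → proj₁ x ∙ proj₁ y , ∙-closed (proj₂ x) (proj₂ y)
    ; ε       = ε , ε-closed
    ; _⁻¹     = λ x → proj₁ x ⁻¹ , ⁻¹-closed (proj₂ x)
    ; isAbelianGroup = record
      { isGroup = record
        { isMonoid = record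
          { isSemigroup = record
            { isMagma = record
              { isEquivalence = record { refl = refl ; sym = sym ; trans = trans }
              ; ∙-cong        = ∙-cong
              }
            ; assoc = λ x y z → assoc (proj₁ x) (proj₁ y) (proj₁ z)
            }
          ; identity = (λ x → identityˡ (proj₁ x)) , (λ x → identityʳ (proj₁ x))
          }
        ; inverse = (λ x → inverseˡ (proj₁ x)) , (λ x → inverseʳ (proj₁ x))
        ; ⁻¹-cong = ⁻¹-cong
        }
      ; comm = λ x y → comm (proj₁ x) (proj₁ y)
      }
    } where open Subgroup H

  ⟨⟩-torsion : (H : Subgroup G p) → Torsion G → Torsion ⟨ H ⟩
  ⟨⟩-torsion H tor (x , x∈) with tor x
  ... | n , eq = n , trans eq (reflexive (same n))
    where
    open Mult (AbelianGroup.commutativeMonoid ⟨ H ⟩) using () renaming (_×_ to _·ᴴ_)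
    same : ∀ n → n · x ≡ proj₁ (n ·ᴴ (x , x∈))
    same zero    = ≡.refl
    same (suc n) = ≡.cong (x ∙_) (same n)

  -‿∙-comm : ∀ a b c d → (a ∙ b) - (c ∙ d) ≈ (a - c) ∙ (b - d)
  -‿∙-comm a b c d = trans (∙-congˡ (sym (⁻¹-∙-comm c d))) (interchange a b (c ⁻¹) (d ⁻¹))

  -‿telescope : ∀ a b c → (a - b) ∙ (b - c) ≈ a - c
  -‿telescope a b c = begin
    (a - b) ∙ (b - c)   ≈⟨ assoc (a - b) b (c ⁻¹) ⟨
    (a - b) ∙ b - c     ≈⟨ ∙-congʳ (//-rightDividesˡ b a) ⟩
    a - c               ∎

infixl 7 _/_

-- The quotient has the same carrier, with x and y identified when x - y
-- lies in K.
_/_ : (G : AbelianGroup g ℓ) → Subgroup G p → AbelianGroup g p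
G / K = record
    { Carrier = Carrier
    ; _≈_     = λ x y → member K (x - y)
    ; _∙_     = _∙_
    ; ε       = ε
    ; _⁻¹     = _⁻¹
    ; isAbelianGroup = record
      { isGroup = record
        { isMonoid = record
          { isSemigroup = record
            { isMagma = record
              { isEquivalence = record
                { refl  = lift refl
                ; sym   = λ {x} {y} x~y → resp (⁻¹-anti-homo‿- x y) (⁻¹-closed x~y)
                ; trans = λ {x} {y} {z} x~y y~z →
                    resp (-‿telescope {G = G} x y z) (∙-closed x~y y~z)
                }
              ; ∙-cong = λ {x} {y} {u} {v} x~y u~v →
                  resp (sym (-‿∙-comm {G = G} x u y v)) (∙-closed x~y u~v)
              }
            ; assoc = λ x y z → lift (assoc x y z)
            }
          ; identity = (λ x → lift (identityˡ x)) , (λ x → lift (identityʳ x))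
          }
        ; inverse = (λ x → lift (inverseˡ x)) , (λ x → lift (inverseʳ x))
        ; ⁻¹-cong = λ {x} {y} x~y →
            resp (sym (⁻¹-∙-comm x (y ⁻¹))) (⁻¹-closed x~y)
        }
      ; comm = λ x y → lift (comm x y)
      }
    }
    where
    open AbelianGroup G
    open AbelianGroupProperties G
    open Subgroup K using (resp; ε-closed; ∙-closed; ⁻¹-closed)
    lift : ∀ {x y} → x ≈ y → member K (x - y)
    lift x≈y = resp (sym (x≈y⇒x∙y⁻¹≈ε x≈y)) ε-closed

-- A partially ordered set whose underlying set is a quotient of G.
record QuotientPoset (G : AbelianGroup g ℓ) p r : Set (g ⊔ ℓ ⊔ lsuc (p ⊔ r)) where
  field
    subgroup       : Subgroup G p
    _⪯_            : Rel (AbelianGroup.Carrier G) r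
    isPartialOrder : IsPartialOrder (AbelianGroup._≈_ (G / subgroup)) _⪯_

-- Equality as partially ordered sets, not merely isomorphism.
SamePoset : {G : AbelianGroup g ℓ} {r s : Level} →
            QuotientPoset G p r → QuotientPoset G q s → Set (g ⊔ p ⊔ q ⊔ r ⊔ s)
SamePoset P Q = (member P.subgroup ≐ member Q.subgroup) × (P._⪯_ ⇔ Q._⪯_)
  where
  module P = QuotientPoset P
  module Q = QuotientPoset Q

------------------------------------------------------------------------
-- Finite and cyclic groups

module FiniteGroup (A : AbelianGroup g ℓ) {n : ℕ} (ord : HasOrder A n) where
  open AbelianGroup A
  open AbelianGroupProperties A
  open Mult commutativeMonoid renaming (_×_ to _·_)
  open Inverse ord using (to; from; to-cong; strictlyInverseˡ; strictlyInverseʳ)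
  open Relation.Binary.Reasoning.Setoid setoid

  to-injective : ∀ {x y} → to x ≡ to y → x ≈ y
  to-injective {x} {y} eq = begin
    x           ≈⟨ strictlyInverseʳ x ⟨
    from (to x) ≡⟨ ≡.cong from eq ⟩
    from (to y) ≈⟨ strictlyInverseʳ y ⟩
    y           ∎

  annihilated : ∀ {i j} x → i ℕ.≤ j → i · x ≈ j · x → (j ℕ.∸ i) · x ≈ ε
  annihilated {i} {j} x i≤j eq = sym (∙-cancelˡ (i · x) _ _ (begin
    i · x ∙ ε               ≈⟨ identityʳ _ ⟩
    i · x                   ≈⟨ eq ⟩
    j · x                   ≡⟨ ≡.cong (_· x) (≡.sym (ℕ.m+[n∸m]≡n i≤j)) ⟩
    (i ℕ.+ (j ℕ.∸ i)) · x   ≈⟨ ×-homo-+ x i (j ℕ.∸ i) ⟩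
    i · x ∙ (j ℕ.∸ i) · x   ∎))

  period : ∀ x → ∃ λ d → suc d ℕ.≤ n × suc d · x ≈ ε
  period x with Fin.pigeonhole (ℕ.n<1+n n) (λ (i : Fin (suc n)) → to (toℕ i · x))
  ... | i , j , i<j , eq with toℕ j ℕ.∸ toℕ i in d≡ | ℕ.m<n⇒0<n∸m i<j
  ...   | suc d | _ =
    d
    , ℕ.≤-trans (ℕ.≤-reflexive (≡.sym d≡)) (ℕ.≤-trans (ℕ.m∸n≤m (toℕ j) (toℕ i)) (ℕ.≤-pred (Fin.toℕ<n j)))
    , (begin
        suc d · x               ≡⟨ ≡.cong (_· x) (≡.sym d≡) ⟩
        (toℕ j ℕ.∸ toℕ i) · x   ≈⟨ annihilated x (ℕ.<⇒≤ i<j) (to-injective eq) ⟩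
        ε                       ∎)

  torsion : Torsion A
  torsion x with period x
  ... | d , _ , eq = d , sym (inverseʳ-unique x (d · x) eq)

  module Cyclic {ρ : Carrier} (gen : IsGenerator A ρ) where

    ℕ-multiple : ∀ x → ∃ λ k → x ≈ k · ρ
    ℕ-multiple x with gen x
    ... | ℤ.+ k , eq = k , eq
    ... | ℤ.-[1+ k ] , eq with torsion (suc k · ρ)
    ...   | t , inv = t ℕ.* suc k , trans eq (trans inv (×-assocˡ ρ t (suc k)))

    bounded-multiple : ∀ d → suc d · ρ ≈ ε → ∀ x → ∃ λ k → k ℕ.< suc d × x ≈ k · ρ
    bounded-multiple d dρ≈ε x with ℕ-multiple x
    ... | k , eq = k′ , ℕ.m%n<n k (suc d) , (begin
      x                              ≈⟨ eq ⟩
      k · ρ                          ≡⟨ ≡.cong (_· ρ) (ℕ.m≡m%n+[m/n]*n k (suc d)) ⟩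
      (k′ ℕ.+ m ℕ.* suc d) · ρ        ≈⟨ ×-homo-+ ρ k′ (m ℕ.* suc d) ⟩
      k′ · ρ ∙ (m ℕ.* suc d) · ρ      ≈⟨ ∙-congˡ (×-assocˡ ρ m (suc d)) ⟨
      k′ · ρ ∙ m · (suc d · ρ)        ≈⟨ ∙-congˡ (×-congʳ m dρ≈ε) ⟩
      k′ · ρ ∙ m · ε                  ≈⟨ ∙-congˡ (·-ε m) ⟩
      k′ · ρ ∙ ε                      ≈⟨ identityʳ _ ⟩
      k′ · ρ                          ∎)
      where
      k′ = k % suc d
      m = k ℕ./ suc d
      ·-ε : ∀ m → m · ε ≈ ε
      ·-ε zero    = refl
      ·-ε (suc m) = trans (identityˡ _) (·-ε m)

    order-minimal : ∀ d → suc d · ρ ≈ ε → n ℕ.≤ suc d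
    order-minimal d dρ≈ε = Fin.injective⇒≤ {f = f} f-injective
      where
      k = λ i → bounded-multiple d dρ≈ε (from i)
      f = λ i → fromℕ< (proj₁ (proj₂ (k i)))
      f-injective : ∀ {i j} → f i ≡ f j → i ≡ j
      f-injective {i} {j} fi≡fj = ≡.trans (≡.sym (strictlyInverseˡ i)) (≡.trans (to-cong (begin
        from i             ≈⟨ proj₂ (proj₂ (k i)) ⟩
        proj₁ (k i) · ρ    ≡⟨ ≡.cong (_· ρ) (Fin.fromℕ<-injective _ _ _ _ fi≡fj) ⟩
        proj₁ (k j) · ρ    ≈⟨ proj₂ (proj₂ (k j)) ⟨
        from j             ∎)) (strictlyInverseˡ j))

    opaque
      n·ρ≈ε : n · ρ ≈ ε
      n·ρ≈ε with period ρ
      ... | d , d≤n , eq = trans (reflexive (≡.cong (_· ρ) (ℕ.≤-antisym (order-minimal d eq) d≤n))) eq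

      representative : ∀ x → ∃ λ b → b ℕ.< n × x ≈ b · ρ
      representative x with period ρ
      ... | d , d≤n , eq with bounded-multiple d eq x
      ...   | b , b<d , x≈ = b , ℕ.<-≤-trans b<d d≤n , x≈

    no-repeat : ∀ {b c} → b ℕ.< c → c ℕ.< n → ¬ (b · ρ ≈ c · ρ)
    no-repeat {b} {c} b<c c<n eq with c ℕ.∸ b in d≡ | ℕ.m<n⇒0<n∸m b<c
    ... | suc d | _ = ℕ.<⇒≱ c<n (ℕ.≤-trans
      (order-minimal d (trans (reflexive (≡.cong (_· ρ) (≡.sym d≡))) (annihilated ρ (ℕ.<⇒≤ b<c) eq)))
      (ℕ.≤-trans (ℕ.≤-reflexive (≡.sym d≡)) (ℕ.m∸n≤m c b)))

    representative-unique : ∀ {b c} → b ℕ.< n → c ℕ.< n → b · ρ ≈ c · ρ → b ≡ c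
    representative-unique {b} {c} b<n c<n eq with ℕ.<-cmp b c
    ... | tri≈ _ b≡c _ = b≡c
    ... | tri< b<c _ _ = ⊥-elim (no-repeat b<c c<n eq)
    ... | tri> _ _ c<b = ⊥-elim (no-repeat c<b b<n (sym eq))

------------------------------------------------------------------------
-- Decomposition of G along a generator of the cyclic quotient G/H

module Decomposition {G : AbelianGroup g ℓ} (H : Subgroup G p) {β : ℕ}
                     (ord : HasOrder (G / H) β)
                     {ρ : AbelianGroup.Carrier G} (gen : IsGenerator (G / H) ρ) where
  open AbelianGroup G
  open AbelianGroupProperties G
  open Mult commutativeMonoid using () renaming (_×_ to _·_)
  open Relation.Binary.Reasoning.Setoid setoid
  open Subgroup H using (resp; ∙-closed; ⁻¹-closed)
  private
    module Q = AbelianGroup (G / H)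
    module QMult = Mult Q.commutativeMonoid
    open FiniteGroup.Cyclic (G / H) ord gen

    same-multiple : ∀ n x → n QMult.× x ≡ n · x
    same-multiple zero    x = ≡.refl
    same-multiple (suc n) x = ≡.cong (x ∙_) (same-multiple n x)

    Q-eq : ∀ n {x} → x Q.≈ n QMult.× ρ → x Q.≈ n · ρ
    Q-eq n {x} = ≡.subst (x Q.≈_) (same-multiple n ρ)

  βρ∈H : member H (β · ρ)
  βρ∈H = resp (begin
    β · ρ - ε     ≈⟨ ∙-congˡ ε⁻¹≈ε ⟩
    β · ρ ∙ ε     ≈⟨ identityʳ _ ⟩
    β · ρ         ∎)
    (≡.subst (λ y → y Q.≈ ε) (same-multiple β ρ) n·ρ≈ε)

  -- In additive notation, x = rem x + coef x · ρ with rem x ∈ H and 0 ≤ coef x < β.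
  coef : Carrier → ℕ
  coef x = proj₁ (representative x)

  coef<β : ∀ x → coef x ℕ.< β
  coef<β x = proj₁ (proj₂ (representative x))

  rem : Carrier → AbelianGroup.Carrier ⟨ H ⟩
  rem x = x - coef x · ρ , Q-eq (coef x) (proj₂ (proj₂ (representative x)))

  decompose : ∀ x → x ≈ proj₁ (rem x) ∙ coef x · ρ
  decompose x = sym (//-rightDividesˡ (coef x · ρ) x)

  coef-unique : ∀ {x b} → b ℕ.< β → member H (x - b · ρ) → coef x ≡ b
  coef-unique {x} {b} b<β x~bρ = representative-unique (coef<β x) b<β
    (Q.trans (Q.sym (proj₂ (proj₂ (representative x))))
             (≡.subst (x Q.≈_) (≡.sym (same-multiple b ρ)) x~bρ))

  coef-cong : ∀ {x y} → member H (x - y) → coef x ≡ coef y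
  coef-cong {x} {y} x~y = coef-unique (coef<β y) (Q.trans {i = x} {j = y} x~y (proj₂ (rem y)))

  private
    rem-difference : ∀ {x y} → coef x ≡ coef y → proj₁ (rem x) - proj₁ (rem y) ≈ x - y
    rem-difference {x} {y} eq = begin
      (x - coef x · ρ) - (y - coef y · ρ)   ≡⟨ ≡.cong (λ c → (x - c · ρ) - (y - coef y · ρ)) eq ⟩
      (x - c) - (y - c)                     ≈⟨ ∙-congˡ (⁻¹-anti-homo‿- y c) ⟩
      (x - c) ∙ (c - y)                     ≈⟨ -‿telescope {G = G} x c y ⟩
      x - y                                 ∎
      where c = coef y · ρ

  coef-≈ : ∀ {x y} → x ≈ y → coef x ≡ coef y
  coef-≈ x≈y = coef-cong (resp (sym (x≈y⇒x∙y⁻¹≈ε x≈y)) (Subgroup.ε-closed H))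

  rem-cong : ∀ {x y} → x ≈ y → proj₁ (rem x) ≈ proj₁ (rem y)
  rem-cong {x} {y} x≈y = x∙y⁻¹≈ε⇒x≈y _ _ (trans
    (rem-difference {x} {y} (coef-≈ x≈y))
    (x≈y⇒x∙y⁻¹≈ε x≈y))

  decompose-unique : ∀ {x b} (a : AbelianGroup.Carrier ⟨ H ⟩) → b ℕ.< β →
                     x ≈ proj₁ a ∙ b · ρ → coef x ≡ b × proj₁ (rem x) ≈ proj₁ a
  decompose-unique {x} {b} (a , a∈H) b<β x≈ = c≡b , (begin
    x - coef x · ρ          ≡⟨ ≡.cong (λ c → x - c · ρ) c≡b ⟩
    x - b · ρ               ≈⟨ x-bρ≈a ⟩
    a                       ∎)
    where
    x-bρ≈a : x - b · ρ ≈ a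
    x-bρ≈a = trans (∙-congʳ x≈) (//-rightDividesʳ (b · ρ) a)
    c≡b = coef-unique b<β (resp (sym x-bρ≈a) a∈H)

  decompose-ε : coef ε ≡ 0 × proj₁ (rem ε) ≈ ε
  decompose-ε = decompose-unique (AbelianGroup.ε ⟨ H ⟩) (ℕ.m<n⇒0<n (coef<β ε)) (sym (identityʳ ε))

  -- A subgroup H′ of H, regarded as a subgroup of G.
  lift : Subgroup ⟨ H ⟩ q → Subgroup G (p ⊔ q)
  lift H′ = record
    { member    = λ x → Σ (member H x) λ x∈H → member H′ (x , x∈H)
    ; resp      = λ { x≈y (x∈H , x∈H′) → resp x≈y x∈H , H′.resp x≈y x∈H′ }
    ; ε-closed  = Subgroup.ε-closed H , H′.ε-closed
    ; ∙-closed  = λ { (x∈H , x∈H′) (y∈H , y∈H′) → ∙-closed x∈H y∈H , H′.∙-closed x∈H′ y∈H′ }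
    ; ⁻¹-closed = λ { (x∈H , x∈H′) → ⁻¹-closed x∈H , H′.⁻¹-closed x∈H′ }
    } where module H′ = Subgroup H′

  -- For P on H/H′, the class of x in G/H′ is (the class of rem x in H/H′) + coef x · ρ, so
  -- the order compares remainders and coefficients.
  monoscopicExtension : QuotientPoset ⟨ H ⟩ q r → QuotientPoset G (p ⊔ q) r
  monoscopicExtension P = record
    { subgroup       = lift P.subgroup
    ; _⪯_            = λ x y → rem x P.⪯ rem y × coef x ℕ.≤ coef y
    ; isPartialOrder = record
      { isPreorder = record
        { isEquivalence = AbelianGroup.isEquivalence (G / lift P.subgroup)
        ; reflexive     = λ {x} {y} (x~y , x~′y) →
            let c≡ = coef-cong {x} {y} x~y in
            P≤.reflexive (H′.resp (sym (rem-difference {x} {y} c≡)) x~′y) , ℕ.≤-reflexive c≡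
        ; trans         = λ (x⪯y , x≤y) (y⪯z , y≤z) → P≤.trans x⪯y y⪯z , ℕ.≤-trans x≤y y≤z
        }
      ; antisym = λ {x} {y} (x⪯y , x≤y) (y⪯x , y≤x) →
          let d = rem-difference {x} {y} (ℕ.≤-antisym x≤y y≤x) in
          resp d (proj₂ (AbelianGroup._-_ ⟨ H ⟩ (rem x) (rem y))) , H′.resp d (P≤.antisym x⪯y y⪯x)
      }
    }
    where
    module P = QuotientPoset P
    module P≤ = IsPartialOrder P.isPartialOrder
    module H′ = Subgroup P.subgroup

------------------------------------------------------------------------
-- Group cones, their faces and Kunz posets

module GroupCone {c ℓ₁ ℓ₂ ℓ₃} (ℝ : Reals c ℓ₁ ℓ₂ ℓ₃) where
  open Reals ℝ
    using (_+_; _*_; -_; 0#; 1#; _≈_; _≤_; _<_)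
    renaming (Carrier to R; _·_ to infixr 8 _·ᴿ_)
  private
    module R = Reals ℝ

  module _ (G : AbelianGroup g ℓ) where
    private module G = AbelianGroup G

    -- The space ℝ^(G∖{0}), each point being given the extra coordinate
    -- x₀ = 0.
    record Point : Set (c ⊔ ℓ₁ ⊔ g ⊔ ℓ) where
      field
        coord      : G.Carrier → R
        coord-cong : ∀ {i j} → i G.≈ j → coord i ≈ coord j
        coord-ε    : coord G.ε ≈ 0#

    open Point

    space : LeftModule R.ring (c ⊔ ℓ₁ ⊔ g ⊔ ℓ) (ℓ₁ ⊔ g)
    space = record
      { Carrierᴹ = Point
      ; _≈ᴹ_     = λ x y → ∀ i → coord x i ≈ coord y i
      ; _+ᴹ_     = λ x y → record
        { coord      = λ i → coord x i + coord y i
        ; coord-cong = λ i≈j → R.+-cong (coord-cong x i≈j) (coord-cong y i≈j)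
        ; coord-ε    = R.trans (R.+-cong (coord-ε x) (coord-ε y)) (R.+-identityˡ 0#)
        }
      ; _*ₗ_     = λ t x → record
        { coord      = λ i → t * coord x i
        ; coord-cong = λ i≈j → R.*-congˡ (coord-cong x i≈j)
        ; coord-ε    = R.trans (R.*-congˡ (coord-ε x)) (R.zeroʳ t)
        }
      ; 0ᴹ       = record
        { coord      = λ _ → 0#
        ; coord-cong = λ _ → R.refl
        ; coord-ε    = R.refl
        }
      ; -ᴹ_      = λ x → record
        { coord      = λ i → - coord x i
        ; coord-cong = λ i≈j → R.-‿cong (coord-cong x i≈j)
        ; coord-ε    = R.trans (R.-‿cong (coord-ε x))
                         (AbelianGroupProperties.ε⁻¹≈ε R.+-abelianGroup)
        }
      ; isLeftModule = record
        { isLeftSemimodule = record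
          { +ᴹ-isCommutativeMonoid = record
            { isMonoid = record
              { isSemigroup = record
                { isMagma = record
                  { isEquivalence = record
                    { refl  = λ i → R.refl
                    ; sym   = λ x≈y i → R.sym (x≈y i)
                    ; trans = λ x≈y y≈z i → R.trans (x≈y i) (y≈z i)
                    }
                  ; ∙-cong = λ x≈y u≈v i → R.+-cong (x≈y i) (u≈v i)
                  }
                ; assoc = λ x y z i → R.+-assoc (coord x i) (coord y i) (coord z i)
                }
              ; identity = (λ x i → R.+-identityˡ (coord x i)) , (λ x i → R.+-identityʳ (coord x i))
              }
            ; comm = λ x y i → R.+-comm (coord x i) (coord y i)
            }
          ; isPreleftSemimodule = record
            { *ₗ-cong      = λ s≈t x≈y i → R.*-cong s≈t (x≈y i)
            ; *ₗ-zeroˡ     = λ x i → R.zeroˡ (coord x i)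
            ; *ₗ-distribʳ  = λ x s t i → R.distribʳ (coord x i) s t
            ; *ₗ-identityˡ = λ x i → R.*-identityˡ (coord x i)
            ; *ₗ-assoc     = λ s t x i → R.*-assoc s t (coord x i)
            ; *ₗ-zeroʳ     = λ s i → R.zeroʳ s
            ; *ₗ-distribˡ  = λ s x y i → R.distribˡ s (coord x i) (coord y i)
            }
          }
        ; -ᴹ‿cong    = λ x≈y i → R.-‿cong (x≈y i)
        ; -ᴹ‿inverse = (λ x i → R.-‿inverseˡ (coord x i)) , (λ x i → R.-‿inverseʳ (coord x i))
        }
      }

    IsLinearFunctional : (Point → R) → Set (c ⊔ ℓ₁ ⊔ g ⊔ ℓ)
    IsLinearFunctional =
      IsLeftModuleHomomorphism (LeftModule.rawLeftModule space)
        (LeftModule.rawLeftModule (TensorUnit.leftModule {R = R.ring}))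

    record Cone (x : Point) : Set (g ⊔ ℓ ⊔ ℓ₃) where
      field
        nonneg   : ∀ i → 0# ≤ coord x i
        triangle : ∀ i j → ¬ (i G.≈ G.ε) → ¬ (j G.≈ G.ε) → ¬ (i G.∙ j G.≈ G.ε) →
                   coord x (i G.∙ j) ≤ coord x i + coord x j

    -- A face of a cone is its intersection with a supporting hyperplane
    -- through the apex.  (The zero functional exposes the cone itself.)
    record IsFace {f} (F : Pred Point f) : Set (c ⊔ ℓ₁ ⊔ ℓ₃ ⊔ g ⊔ ℓ ⊔ f) where
      field
        functional : Point → R
        linear     : IsLinearFunctional functional
        supporting : ∀ {x} → Cone x → 0# ≤ functional x
        exposed    : F ≐ (Cone ∩ λ x → functional x ≈ 0#)

  open Point
  open Cone

  module Kunz {G : AbelianGroup g ℓ} (tor : Torsion G) {f} {F : Pred (Point G) f}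
              (face : IsFace G F) where
    private
      module G = AbelianGroup G
      module GP = AbelianGroupProperties G
      module RP = AbelianGroupProperties R.+-abelianGroup
      open G using (_∙_; _⁻¹; ε) renaming (_-_ to _⊖_)
      open Mult G.commutativeMonoid using () renaming (_×_ to _·_)
      open Relation.Binary.Reasoning.PartialOrder R.≤-poset

      F⊆C : F ⊆ Cone G
      F⊆C x∈F = proj₁ (proj₁ (IsFace.exposed face) x∈F)

      0≤ : ∀ {x} → F x → ∀ i → 0# ≤ coord x i
      0≤ x∈F = nonneg (F⊆C x∈F)

      subadditive : ∀ {x} → F x → ∀ i j → coord x (i ∙ j) ≤ coord x i + coord x j
      subadditive {x} x∈F i j lt = triangle (F⊆C x∈F) i j i≉ε j≉ε ij≉ε lt
        where
        i≉ε : ¬ (i G.≈ ε)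
        i≉ε i≈ε = R.<-irrefl (R.trans (R.+-congʳ (R.trans (coord-cong x i≈ε) (coord-ε x)))
          (R.trans (R.+-identityˡ _) (coord-cong x (G.sym (G.trans (G.∙-congʳ i≈ε) (G.identityˡ j)))))) lt
        j≉ε : ¬ (j G.≈ ε)
        j≉ε j≈ε = R.<-irrefl (R.trans (R.+-congˡ (R.trans (coord-cong x j≈ε) (coord-ε x)))
          (R.trans (R.+-identityʳ _) (coord-cong x (G.sym (G.trans (G.∙-congˡ j≈ε) (G.identityʳ i)))))) lt
        ij≉ε : ¬ (i ∙ j G.≈ ε)
        ij≉ε ij≈ε = (begin
          coord x (i ∙ j)        ≈⟨ coord-cong x ij≈ε ⟩
          coord x ε              ≈⟨ coord-ε x ⟩
          0#                     ≈⟨ R.+-identityˡ 0# ⟨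
          0# + 0#                ≤⟨ R.+-mono-≤ (0≤ x∈F i) (0≤ x∈F j) ⟩
          coord x i + coord x j  ∎) lt

      split : ∀ {x} → F x → ∀ a b → coord x b ≤ coord x a + coord x (b ⊖ a)
      split {x} x∈F a b = begin
        coord x b                      ≈⟨ coord-cong x (G.trans (G.comm a (b ⊖ a)) (GP.//-rightDividesˡ a b)) ⟨
        coord x (a ∙ (b ⊖ a))          ≤⟨ subadditive x∈F a (b ⊖ a) ⟩
        coord x a + coord x (b ⊖ a)    ∎

      zero-sum : ∀ {u v} → 0# ≤ u → 0# ≤ v → u + v ≈ 0# → u ≈ 0#
      zero-sum {u} {v} 0≤u 0≤v eq = R.≤-antisym (begin
        u        ≈⟨ R.+-identityʳ u ⟨
        u + 0#   ≤⟨ R.+-mono-≤ R.≤-refl 0≤v ⟩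
        u + v    ≈⟨ eq ⟩
        0#       ∎) 0≤u

      Vanishing : Pred G.Carrier (c ⊔ ℓ₁ ⊔ g ⊔ ℓ ⊔ f)
      Vanishing a = ∀ {x} → F x → coord x a ≈ 0#

      ε-vanishing : Vanishing ε
      ε-vanishing {x} _ = coord-ε x

      ∙-vanishing : ∀ {a b} → Vanishing a → Vanishing b → Vanishing (a ∙ b)
      ∙-vanishing {a} {b} va vb {x} x∈F = R.≤-antisym (begin
        coord x (a ∙ b)        ≤⟨ subadditive x∈F a b ⟩
        coord x a + coord x b  ≈⟨ R.+-cong (va x∈F) (vb x∈F) ⟩
        0# + 0#                ≈⟨ R.+-identityˡ 0# ⟩
        0#                     ∎) (0≤ x∈F (a ∙ b))

      ·-vanishing : ∀ n {a} → Vanishing a → Vanishing (n · a)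
      ·-vanishing zero    va = ε-vanishing
      ·-vanishing (suc n) va = ∙-vanishing va (·-vanishing n va)

    kunzSubgroup : Subgroup G (c ⊔ ℓ₁ ⊔ g ⊔ ℓ ⊔ f)
    kunzSubgroup = record
      { member    = λ a → ∀ {x} → F x → coord x a ≈ 0#
      ; resp      = λ a≈b va {x} x∈F → R.trans (coord-cong x (G.sym a≈b)) (va x∈F)
      ; ε-closed  = ε-vanishing
      ; ∙-closed  = ∙-vanishing
      ; ⁻¹-closed = λ {a} va {x} x∈F →
          R.trans (coord-cong x (proj₂ (tor a))) (·-vanishing (proj₁ (tor a)) va x∈F)
      }

    private
      infix 4 _⪯_
      _⪯_ : Rel G.Carrier (c ⊔ ℓ₁ ⊔ g ⊔ ℓ ⊔ f)
      a ⪯ b = ∀ {x} → F x → coord x a + coord x (b ⊖ a) ≈ coord x b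

      same-coord : ∀ {a b} → Vanishing (a ⊖ b) → ∀ {x} → F x → coord x a ≤ coord x b
      same-coord {a} {b} v {x} x∈F = begin
        coord x a                     ≤⟨ split x∈F b a ⟩
        coord x b + coord x (a ⊖ b)   ≈⟨ R.+-congˡ (v x∈F) ⟩
        coord x b + 0#                ≈⟨ R.+-identityʳ _ ⟩
        coord x b                     ∎

      ⪯-reflexive : ∀ {a b} → Vanishing (a ⊖ b) → a ⪯ b
      ⪯-reflexive {a} {b} v {x} x∈F = R.trans (R.+-congˡ (v′ x∈F))
        (R.trans (R.+-identityʳ _) (R.≤-antisym (same-coord v x∈F) (same-coord v′ x∈F)))
        where
        v′ : Vanishing (b ⊖ a)
        v′ = Q.sym {x = a} {y = b} v
          where module Q = AbelianGroup (G / kunzSubgroup)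

      ⪯-antisym : ∀ {a b} → a ⪯ b → b ⪯ a → Vanishing (a ⊖ b)
      ⪯-antisym {a} {b} a⪯b b⪯a {x} x∈F =
        zero-sum (0≤ x∈F (a ⊖ b)) (0≤ x∈F (b ⊖ a))
          (RP.identityʳ-unique (coord x b) _
            (R.trans (R.sym (R.+-assoc _ _ _)) (R.trans (R.+-congʳ (b⪯a x∈F)) (a⪯b x∈F))))

      ⪯-trans : ∀ {a b d} → a ⪯ b → b ⪯ d → a ⪯ d
      ⪯-trans {a} {b} {d} a⪯b b⪯d {x} x∈F = R.≤-antisym (begin
        coord x a + coord x (d ⊖ a)                         ≈⟨ R.+-congˡ (coord-cong x
                                                                 (G.trans (G.comm _ _) (-‿telescope {G = G} d b a))) ⟨
        coord x a + coord x ((b ⊖ a) ∙ (d ⊖ b))             ≤⟨ R.+-mono-≤ R.≤-refl (subadditive x∈F (b ⊖ a) (d ⊖ b)) ⟩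
        coord x a + (coord x (b ⊖ a) + coord x (d ⊖ b))     ≈⟨ R.+-assoc _ _ _ ⟨
        coord x a + coord x (b ⊖ a) + coord x (d ⊖ b)       ≈⟨ R.+-congʳ (a⪯b x∈F) ⟩
        coord x b + coord x (d ⊖ b)                         ≈⟨ b⪯d x∈F ⟩
        coord x d                                           ∎) (split x∈F a d)

    kunzPoset : QuotientPoset G (c ⊔ ℓ₁ ⊔ g ⊔ ℓ ⊔ f) (c ⊔ ℓ₁ ⊔ g ⊔ ℓ ⊔ f)
    kunzPoset = record
      { subgroup       = kunzSubgroup
      ; _⪯_            = λ a b → ∀ {x} → F x → coord x a + coord x (b ⊖ a) ≈ coord x b
      ; isPartialOrder = record
        { isPreorder = record
          { isEquivalence = AbelianGroup.isEquivalence (G / kunzSubgroup)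
          ; reflexive     = λ {a} {b} → ⪯-reflexive {a} {b}
          ; trans         = λ {a} {b} {d} → ⪯-trans {a} {b} {d}
          }
        ; antisym = λ {a} {b} → ⪯-antisym {a} {b}
        }
      }

  module Monoscopic {G : AbelianGroup g ℓ} (H : Subgroup G p) {β : ℕ}
                    (ord : HasOrder (G / H) β)
                    {ρ : AbelianGroup.Carrier G} (gen : IsGenerator (G / H) ρ) where
    private module G = AbelianGroup G
    open G using (_∙_)
    open Mult G.commutativeMonoid using () renaming (_×_ to _·_)
    open Decomposition H ord gen
    open LeftModule (space G) using (_+ᴹ_; _*ₗ_; _≈ᴹ_)
    private
      module RM = Mult R.+-commutativeMonoid

      ·ᴿ-0 : ∀ n → n ·ᴿ 0# ≈ 0#
      ·ᴿ-0 zero    = R.refl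
      ·ᴿ-0 (suc n) = R.trans (R.+-identityˡ _) (·ᴿ-0 n)

    embedding : Point ⟨ H ⟩ → Point G
    embedding w = record
      { coord      = λ i → β ·ᴿ coord w (rem i) + coef i ·ᴿ coord w (β · ρ , βρ∈H)
      ; coord-cong = λ {i} {j} i≈j → R.+-cong
          (RM.×-congʳ β (coord-cong w (rem-cong i≈j)))
          (RM.×-congˡ (coef-≈ i≈j))
      ; coord-ε    = R.trans
          (R.+-cong (R.trans (RM.×-congʳ β (R.trans (coord-cong w (proj₂ decompose-ε)) (coord-ε w))) (·ᴿ-0 β))
                    (RM.×-congˡ (proj₁ decompose-ε)))
          (R.+-identityˡ 0#)
      }

    betaRay : Point G
    betaRay = record
      { coord      = λ i → coef i ·ᴿ 1#
      ; coord-cong = λ i≈j → RM.×-congˡ (coef-≈ i≈j)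
      ; coord-ε    = R.reflexive (≡.cong (_·ᴿ 1#) (proj₁ decompose-ε))
      }

    embedding-coord : ∀ w (a : AbelianGroup.Carrier ⟨ H ⟩) {b} → b ℕ.< β →
                      coord (embedding w) (proj₁ a ∙ b · ρ) ≈
                      β ·ᴿ coord w a + b ·ᴿ coord w (β · ρ , βρ∈H)
    embedding-coord w a b<β = R.+-cong
      (RM.×-congʳ β (coord-cong w (proj₂ (decompose-unique a b<β G.refl))))
      (RM.×-congˡ (proj₁ (decompose-unique a b<β G.refl)))

    betaRay-coord : ∀ (a : AbelianGroup.Carrier ⟨ H ⟩) {b} → b ℕ.< β →
                    coord betaRay (proj₁ a ∙ b · ρ) ≈ b ·ᴿ 1#
    betaRay-coord a b<β = RM.×-congˡ (proj₁ (decompose-unique a b<β G.refl))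

    -- ℝ≥0 s + Φ(F)
    Extension : ∀ {f} → Pred (Point ⟨ H ⟩) f → Pred (Point G) (c ⊔ ℓ₁ ⊔ ℓ₃ ⊔ g ⊔ ℓ ⊔ p ⊔ f)
    Extension F x = ∃₂ λ t w → 0# ≤ t × F w × x ≈ᴹ (t *ₗ betaRay) +ᴹ embedding w

{-# OPTIONS --safe #-}

module Submission where

-- Put u = t + w_{βρ}.  The points t s + Φ(w) are those with
-- x_{a+bρ} = β w_a + b u, where w_{βρ} ≤ u; subadditivity of w gives that of
-- x, the bound on u absorbing a carry b + b' ≥ β.  Conversely, every point of
-- C(G) satisfies x_{a+bρ} ≤ x_a + b x_ρ, and if all of these are equalities,
-- then x has this form with w = x|_H / β and u = x_ρ.  So if φ exposes F, then
--   x ↦ ∑_{a,b} (x_a + b x_ρ - x_{a+bρ}) + φ(x|_H)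
-- exposes ℝ≥0 s + Φ(F).  For the Kunz poset, s itself forces the coefficients
-- of ρ to add without carry, after which only the remainders in H matter.

open import Algebra.Bundles using (AbelianGroup; CommutativeMonoid)
open import Algebra.Module.Bundles using (LeftModule)
open import Algebra.Module.Morphism.Structures using (IsLeftModuleHomomorphism)
import Algebra.Properties.AbelianGroup as AbelianGroupProperties
import Algebra.Properties.CommutativeMonoid.Mult as Mult
open import Algebra.Properties.CommutativeMonoid.Sum using (sum)
import Algebra.Properties.CommutativeSemigroup as CommutativeSemigroupProperties
import Algebra.Properties.Ring as RingProperties
import Algebra.Properties.Semiring.Mult as SemiringMult
open import Data.Empty using (⊥-elim)
open import Data.Fin.Base as Fin using (Fin)
open import Data.Nat.Base as ℕ using (ℕ; zero; suc)
import Data.Nat.Properties as ℕ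
open import Data.Product.Base using (∃; ∃₂; Σ; _×_; _,_; proj₁; proj₂)
open import Data.Sum.Base using (_⊎_; inj₁; inj₂)
open import Function.Bundles using (Inverse)
open import Level using (Level; _⊔_)
import Relation.Binary.Reasoning.PartialOrder
import Relation.Binary.Reasoning.Setoid
open import Relation.Binary.PropositionalEquality as ≡ using (_≡_)
open import Relation.Nullary.Decidable using (yes; no)
open import Relation.Unary using (Pred)
open import Defs

private
  variable
    g ℓ p f : Level

-- Ordered-field arithmetic: natural multiples, finite sums and reciprocals.

module OrderedField {c ℓ₁ ℓ₂ ℓ₃ : Level} (ℝ : Reals c ℓ₁ ℓ₂ ℓ₃) where
  open Reals ℝ
  open Mult +-commutativeMonoid using (×-congʳ)
  open SemiringMult semiring using (×-assoc-*)
  open AbelianGroupProperties +-abelianGroup using (⁻¹-involutive; ε⁻¹≈ε; ∙-cancelˡ)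
  open Relation.Binary.Reasoning.PartialOrder ≤-poset

  open CommutativeSemigroupProperties (CommutativeMonoid.commutativeSemigroup +-commutativeMonoid) public
    using () renaming (interchange to +-interchange)

  ·-zeroʳ : ∀ n → n · 0# ≈ 0#
  ·-zeroʳ zero    = refl
  ·-zeroʳ (suc n) = trans (+-identityˡ _) (·-zeroʳ n)

  ≤-difference : ∀ {x y} → x ≤ y → 0# ≤ y - x
  ≤-difference {x} {y} x≤y = begin
    0#      ≈⟨ -‿inverseʳ x ⟨
    x - x   ≤⟨ +-monoˡ-≤ (- x) x≤y ⟩
    y - x   ∎

  +-nonneg : ∀ {x y} → 0# ≤ x → 0# ≤ y → 0# ≤ x + y
  +-nonneg {x} {y} 0≤x 0≤y = begin
    0#        ≈⟨ +-identityˡ 0# ⟨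
    0# + 0#   ≤⟨ +-mono-≤ 0≤x 0≤y ⟩
    x + y     ∎

  nonneg-sum-zero : ∀ {x y} → 0# ≤ x → 0# ≤ y → x + y ≈ 0# → x ≈ 0# × y ≈ 0#
  nonneg-sum-zero {x} {y} 0≤x 0≤y eq = ≤-antisym x≤0 0≤x , ≤-antisym y≤0 0≤y
    where
    x≤0 = begin
      x        ≈⟨ +-identityʳ x ⟨
      x + 0#   ≤⟨ +-mono-≤ ≤-refl 0≤y ⟩
      x + y    ≈⟨ eq ⟩
      0#       ∎
    y≤0 = begin
      y        ≈⟨ +-identityˡ y ⟨
      0# + y   ≤⟨ +-mono-≤ 0≤x ≤-refl ⟩
      x + y    ≈⟨ eq ⟩
      0#       ∎

  ∑ : ∀ {n} → (Fin n → Carrier) → Carrier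
  ∑ = sum +-commutativeMonoid

  ∑-nonneg : ∀ {n} {h : Fin n → Carrier} → (∀ k → 0# ≤ h k) → 0# ≤ ∑ h
  ∑-nonneg {zero}  0≤h = ≤-refl
  ∑-nonneg {suc n} 0≤h = +-nonneg (0≤h Fin.zero) (∑-nonneg λ k → 0≤h (Fin.suc k))

  ∑-zero : ∀ {n} {h : Fin n → Carrier} → (∀ k → h k ≈ 0#) → ∑ h ≈ 0#
  ∑-zero {zero}  h≈0 = refl
  ∑-zero {suc n} h≈0 = trans (+-cong (h≈0 Fin.zero) (∑-zero λ k → h≈0 (Fin.suc k))) (+-identityˡ 0#)

  ∑-zero⁻¹ : ∀ {n} {h : Fin n → Carrier} → (∀ k → 0# ≤ h k) → ∑ h ≈ 0# → ∀ k → h k ≈ 0#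
  ∑-zero⁻¹ {suc n} {h} 0≤h eq = λ where
      Fin.zero    → proj₁ zeros
      (Fin.suc k) → ∑-zero⁻¹ (λ k → 0≤h (Fin.suc k)) (proj₂ zeros) k
    where
    zeros = nonneg-sum-zero (0≤h Fin.zero) (∑-nonneg λ k → 0≤h (Fin.suc k)) eq

  ·-mono-≤ : ∀ n {x y} → x ≤ y → n · x ≤ n · y
  ·-mono-≤ zero    x≤y = ≤-refl
  ·-mono-≤ (suc n) x≤y = +-mono-≤ x≤y (·-mono-≤ n x≤y)

  ·-nonneg : ∀ n {x} → 0# ≤ x → 0# ≤ n · x
  ·-nonneg n {x} 0≤x = begin
    0#       ≈⟨ ·-zeroʳ n ⟨
    n · 0#   ≤⟨ ·-mono-≤ n 0≤x ⟩
    n · x    ∎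

  +-mono-< : ∀ {x y u v} → x < y → u < v → x + u < y + v
  +-mono-< {x} {y} {u} {v} x<y u<v =
    <-trans (+-monoˡ-< u x<y) (<-respˡ-≈ (+-comm u y) (<-respʳ-≈ (+-comm v y) (+-monoˡ-< y u<v)))

  ·-mono-< : ∀ n {x y} → x < y → suc n · x < suc n · y
  ·-mono-< zero    x<y = +-monoˡ-< 0# x<y
  ·-mono-< (suc n) x<y = +-mono-< x<y (·-mono-< n x<y)

  -- As `x ≤ y` is the negation of `y < x`, cancellation is the contrapositive of strict
  -- monotonicity of multiplication by a positive natural number. Every later division by `β` in an
  -- inequality or equation goes through it.
  ·-cancel-≤ : ∀ n .{{_ : ℕ.NonZero n}} {x y} → n · x ≤ n · y → x ≤ y
  ·-cancel-≤ (suc n) nx≤ny y<x = nx≤ny (·-mono-< n y<x)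

  ·-cancel-≈ : ∀ n .{{_ : ℕ.NonZero n}} {x y} → n · x ≈ n · y → x ≈ y
  ·-cancel-≈ n eq = ≤-antisym (·-cancel-≤ n (≤-reflexive eq)) (·-cancel-≤ n (≤-reflexive (sym eq)))

  -- Apartness from zero is invertibility, so `1#` is apart from `0#` and is either positive or
  -- negative. If it were negative, then `- 1#` would be positive, and so would its square `1#`.
  0<1 : 0# < 1#
  0<1 with #⇒<⊎> (invertible⇒# {1#} {0#} (1# , 1·[1-0]≈1 , trans (*-comm _ _) 1·[1-0]≈1))
    where
    1·[1-0]≈1 : 1# * (1# - 0#) ≈ 1#
    1·[1-0]≈1 = trans (*-identityˡ _) (trans (+-congˡ ε⁻¹≈ε) (+-identityʳ 1#))
  ... | inj₂ 0<1 = 0<1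
  ... | inj₁ 1<0 = ⊥-elim (<-irrefl refl (<-trans 1<0 (<-respʳ-≈ square (*-pos 0<-1 0<-1))))
    where
    open RingProperties ring using (-‿distribˡ-*)
    0<-1 : 0# < - 1#
    0<-1 = <-respˡ-≈ (-‿inverseʳ 1#) (<-respʳ-≈ (+-identityˡ _) (+-monoˡ-< (- 1#) 1<0))
    square : - 1# * - 1# ≈ 1#
    square = trans (sym (-‿distribˡ-* 1# (- 1#))) (trans (-‿cong (*-identityˡ _)) (⁻¹-involutive 1#))

  0<n·1 : ∀ n → 0# < suc n · 1#
  0<n·1 n = <-respˡ-≈ (·-zeroʳ (suc n)) (·-mono-< n 0<1)

  -- Characteristic zero, from positivity of `suc n · 1#`. It turns identities between coordinates
  -- of the beta ray into identities between coefficients in ℕ.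
  ·1-injective : ∀ m n → m · 1# ≈ n · 1# → m ≡ n
  ·1-injective zero    zero    eq = ≡.refl
  ·1-injective zero    (suc n) eq = ⊥-elim (<-irrefl eq (0<n·1 n))
  ·1-injective (suc m) zero    eq = ⊥-elim (<-irrefl (sym eq) (0<n·1 m))
  ·1-injective (suc m) (suc n) eq = ≡.cong suc (·1-injective m n (∙-cancelˡ 1# _ _ eq))

  -- Positive elements are apart from zero, hence invertible. The identity is phrased with the
  -- natural multiple `n ·_`, the form in which `β` enters the coordinates of the embedding.
  reciprocal : ∀ n .{{_ : ℕ.NonZero n}} → ∃ λ y → ∀ x → n · (y * x) ≈ x
  reciprocal (suc n) with #⇒invertible (#-sym (<⇒# (0<n·1 n)))
  ... | y , _ , [n-0]y≈1 = y , λ x → begin-equality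
    suc n · (y * x)             ≈⟨ ×-congʳ (suc n) (*-identityˡ (y * x)) ⟨
    suc n · (1# * (y * x))      ≈⟨ ×-assoc-* (suc n) 1# (y * x) ⟨
    suc n · 1# * (y * x)        ≈⟨ *-assoc _ y x ⟨
    suc n · 1# * y * x          ≈⟨ *-congʳ (*-congʳ (trans (+-congˡ ε⁻¹≈ε) (+-identityʳ _))) ⟨
    (suc n · 1# - 0#) * y * x   ≈⟨ *-congʳ [n-0]y≈1 ⟩
    1# * x                      ≈⟨ *-identityˡ x ⟩
    x                           ∎

-- Remainders and coefficients under sums and differences in G.

module DecompositionProperties {G : AbelianGroup g ℓ} (H : Subgroup G p) {β : ℕ}
                               (ord : HasOrder (G / H) β)
                               {ρ : AbelianGroup.Carrier G} (gen : IsGenerator (G / H) ρ) where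
  open AbelianGroup G
  open AbelianGroupProperties G using (//-rightDividesʳ; ε⁻¹≈ε)
  open CommutativeSemigroupProperties commutativeSemigroup using (interchange)
  open Mult commutativeMonoid using (×-homo-+; ×-congˡ) renaming (_×_ to _·_)
  open Relation.Binary.Reasoning.Setoid setoid
  open Decomposition H ord gen
  private
    module H = AbelianGroup ⟨ H ⟩

  0<β : 0 ℕ.< β
  0<β = ℕ.m<n⇒0<n (coef<β ε)

  instance
    β-nonZero : ℕ.NonZero β
    β-nonZero = ℕ.>-nonZero 0<β

  decompose-member : ∀ a → coef (proj₁ a) ≡ 0 × proj₁ (rem (proj₁ a)) ≈ proj₁ a
  decompose-member a = decompose-unique a 0<β (sym (identityʳ (proj₁ a)))

  coef≡0⇒rem≈ : ∀ {x} → coef x ≡ 0 → proj₁ (rem x) ≈ x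
  coef≡0⇒rem≈ {x} c≡0 = begin
    x - coef x · ρ   ≈⟨ ∙-congˡ (⁻¹-cong (×-congˡ c≡0)) ⟩
    x - ε            ≈⟨ ∙-congˡ ε⁻¹≈ε ⟩
    x ∙ ε            ≈⟨ identityʳ x ⟩
    x                ∎

  -- The bound matters: for `β = 1` the generator lies in H, with coefficient 0 and remainder `ρ`
  -- itself.
  decompose-ρ : 1 ℕ.< β → coef ρ ≡ 1 × proj₁ (rem ρ) ≈ ε
  decompose-ρ 1<β = decompose-unique H.ε 1<β (sym (trans (identityˡ _) (identityʳ ρ)))

  private
    product : ∀ x y → x ∙ y ≈ proj₁ (rem x H.∙ rem y) ∙ (coef x ℕ.+ coef y) · ρ
    product x y = begin
      x ∙ y                                                         ≈⟨ ∙-cong (decompose x) (decompose y) ⟩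
      (proj₁ (rem x) ∙ coef x · ρ) ∙ (proj₁ (rem y) ∙ coef y · ρ)   ≈⟨ interchange _ _ _ _ ⟩
      (proj₁ (rem x) ∙ proj₁ (rem y)) ∙ (coef x · ρ ∙ coef y · ρ)   ≈⟨ ∙-congˡ (×-homo-+ ρ (coef x) (coef y)) ⟨
      (proj₁ (rem x) ∙ proj₁ (rem y)) ∙ (coef x ℕ.+ coef y) · ρ     ∎

  -- Addition with carry in base `β`: when the coefficients sum to at least `β`, the multiple
  -- `β · ρ` lies in H and moves into the remainder.
  decompose-∙ : ∀ x y →
    (coef (x ∙ y) ≡ coef x ℕ.+ coef y × proj₁ (rem (x ∙ y)) ≈ proj₁ (rem x H.∙ rem y)) ⊎
    (β ℕ.+ coef (x ∙ y) ≡ coef x ℕ.+ coef y ×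
     proj₁ (rem (x ∙ y)) ≈ proj₁ ((rem x H.∙ rem y) H.∙ (β · ρ , βρ∈H)))
  decompose-∙ x y with coef x ℕ.+ coef y ℕ.<? β
  ... | yes c<β = inj₁ (decompose-unique (rem x H.∙ rem y) c<β (product x y))
  ... | no c≮β = inj₂ (≡.trans (≡.cong (β ℕ.+_) (proj₁ unique)) β+k≡ , proj₂ unique)
    where
    k = coef x ℕ.+ coef y ℕ.∸ β
    β+k≡ : β ℕ.+ k ≡ coef x ℕ.+ coef y
    β+k≡ = ℕ.m+[n∸m]≡n (ℕ.≮⇒≥ c≮β)
    -- Both coefficients are below `β`, so their sum is below `β + β` and a single carry suffices.
    k<β : k ℕ.< β
    k<β = ℕ.+-cancelˡ-< β k β (≡.subst (ℕ._< β ℕ.+ β) (≡.sym β+k≡) (ℕ.+-mono-< (coef<β x) (coef<β y)))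
    unique = decompose-unique ((rem x H.∙ rem y) H.∙ (β · ρ , βρ∈H)) k<β (begin
      x ∙ y                                                       ≈⟨ product x y ⟩
      (proj₁ (rem x) ∙ proj₁ (rem y)) ∙ (coef x ℕ.+ coef y) · ρ   ≈⟨ ∙-congˡ (×-congˡ β+k≡) ⟨
      (proj₁ (rem x) ∙ proj₁ (rem y)) ∙ (β ℕ.+ k) · ρ             ≈⟨ ∙-congˡ (×-homo-+ ρ β k) ⟩
      (proj₁ (rem x) ∙ proj₁ (rem y)) ∙ (β · ρ ∙ k · ρ)           ≈⟨ assoc _ _ _ ⟨
      ((proj₁ (rem x) ∙ proj₁ (rem y)) ∙ β · ρ) ∙ k · ρ           ∎)

  -- Without a borrow the termwise difference already has its coefficient in the range from 0 to
  -- `β - 1`, so uniqueness of the decomposition applies.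
  decompose-difference : ∀ {x y} → coef x ℕ.≤ coef y →
    coef (y - x) ≡ coef y ℕ.∸ coef x × proj₁ (rem (y - x)) ≈ proj₁ (rem y H.- rem x)
  decompose-difference {x} {y} cx≤cy =
    decompose-unique (rem y H.- rem x) (ℕ.≤-<-trans (ℕ.m∸n≤m (coef y) (coef x)) (coef<β y)) (begin
      y - x                                                              ≈⟨ ∙-cong (decompose y) (⁻¹-cong (decompose x)) ⟩
      (proj₁ (rem y) ∙ coef y · ρ) - (proj₁ (rem x) ∙ coef x · ρ)        ≈⟨ -‿∙-comm {G = G} _ _ _ _ ⟩
      (proj₁ (rem y) - proj₁ (rem x)) ∙ (coef y · ρ - coef x · ρ)        ≈⟨ ∙-congˡ (∙-congʳ (×-congˡ (ℕ.m∸n+n≡m cx≤cy))) ⟨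
      (proj₁ (rem y) - proj₁ (rem x)) ∙ ((k ℕ.+ coef x) · ρ - coef x · ρ) ≈⟨ ∙-congˡ (∙-congʳ (×-homo-+ ρ k (coef x))) ⟩
      (proj₁ (rem y) - proj₁ (rem x)) ∙ (k · ρ ∙ coef x · ρ - coef x · ρ) ≈⟨ ∙-congˡ (//-rightDividesʳ (coef x · ρ) (k · ρ)) ⟩
      (proj₁ (rem y) - proj₁ (rem x)) ∙ k · ρ                            ∎)
    where k = coef y ℕ.∸ coef x

-- Subadditivity on the cone, linear functionals and restriction to a subgroup.

module ConeProperties {c ℓ₁ ℓ₂ ℓ₃ : Level} (ℝ : Reals c ℓ₁ ℓ₂ ℓ₃) where
  open GroupCone ℝ
  open OrderedField ℝ
  private
    module R = Reals ℝ
    module RP = RingProperties R.ring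
  open R using (_+_; _*_; -_; 0#; 1#; _≈_; _≤_) renaming (_·_ to infixr 8 _·ᴿ_)
  open Point
  open Cone
  open Relation.Binary.Reasoning.PartialOrder R.≤-poset
  open AbelianGroupProperties R.+-abelianGroup using (⁻¹-∙-comm)

  module _ (G : AbelianGroup g ℓ) where
    private module G = AbelianGroup G
    open LeftModule (space G) using (_≈ᴹ_; _+ᴹ_; _*ₗ_; 0ᴹ; -ᴹ_)
    open Mult G.commutativeMonoid using () renaming (_×_ to _·_)

    -- Extends the triangle inequality to the cases that the cone leaves out: a zero summand gives
    -- equality because `x₀ = 0`, and a zero sum gives nonnegativity of the right side. As `≤` is a
    -- negation, each case is refuted from the assumed strict inequality, without deciding equality
    -- in G.
    subadditive : ∀ {x} → Cone G x → ∀ i j → coord x (i G.∙ j) ≤ coord x i + coord x j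
    subadditive {x} C i j lt = triangle C i j i≉ε j≉ε ij≉ε lt
      where
      i≉ε = λ i≈ε → R.<-irrefl (R.trans (R.+-congʳ (R.trans (coord-cong x i≈ε) (coord-ε x)))
        (R.trans (R.+-identityˡ _) (coord-cong x (G.sym (G.trans (G.∙-congʳ i≈ε) (G.identityˡ j)))))) lt
      j≉ε = λ j≈ε → R.<-irrefl (R.trans (R.+-congˡ (R.trans (coord-cong x j≈ε) (coord-ε x)))
        (R.trans (R.+-identityʳ _) (coord-cong x (G.sym (G.trans (G.∙-congˡ j≈ε) (G.identityʳ i)))))) lt
      ij≉ε = λ ij≈ε → (begin
        coord x (i G.∙ j)      ≈⟨ R.trans (coord-cong x ij≈ε) (coord-ε x) ⟩
        0#                     ≤⟨ +-nonneg (nonneg C i) (nonneg C j) ⟩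
        coord x i + coord x j  ∎) lt

    ·-subadditive : ∀ {x} → Cone G x → ∀ n i → coord x (n · i) ≤ n ·ᴿ coord x i
    ·-subadditive {x} C zero    i = R.≤-reflexive (coord-ε x)
    ·-subadditive {x} C (suc n) i =
      R.≤-trans (subadditive C i (n · i)) (R.+-mono-≤ R.≤-refl (·-subadditive C n i))

    0ᴹ∈Cone : Cone G 0ᴹ
    0ᴹ∈Cone = record
      { nonneg   = λ _ → R.≤-refl
      ; triangle = λ _ _ _ _ _ → +-nonneg R.≤-refl R.≤-refl
      }

    -- Preservation of zero and of negatives is homogeneity for the scalars `0#` and `- 1#`.
    isLinear : ∀ {h} → (∀ {x y} → x ≈ᴹ y → h x ≈ h y) →
               (∀ x y → h (x +ᴹ y) ≈ h x + h y) → (∀ t x → h (t *ₗ x) ≈ t * h x) →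
               IsLinearFunctional G h
    isLinear {h} h-cong h-+ h-* = record
      { +ᴹ-isGroupHomomorphism = record
        { isMonoidHomomorphism = record
          { isMagmaHomomorphism = record
            { isRelHomomorphism = record { cong = h-cong }
            ; homo              = h-+
            }
          ; ε-homo = R.trans (h-cong {0ᴹ} {0# *ₗ 0ᴹ} (λ i → R.sym (R.zeroˡ 0#)))
              (R.trans (h-* 0# 0ᴹ) (R.zeroˡ _))
          }
        ; ⁻¹-homo = λ x → R.trans (h-cong {(-ᴹ x)} {(- 1#) *ₗ x} (λ i → R.sym (RP.-1*x≈-x (coord x i))))
            (R.trans (h-* (- 1#) x) (RP.-1*x≈-x (h x)))
        }
      ; *ₗ-homo = h-*
      }

    coord-linear : ∀ i → IsLinearFunctional G (λ x → coord x i)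
    coord-linear i = isLinear (λ x≈y → x≈y i) (λ _ _ → R.refl) (λ _ _ → R.refl)

    0-linear : IsLinearFunctional G (λ _ → 0#)
    0-linear = isLinear (λ _ → R.refl) (λ _ _ → R.sym (R.+-identityˡ 0#)) (λ t _ → R.sym (R.zeroʳ t))

    +-linear : ∀ {h k} → IsLinearFunctional G h → IsLinearFunctional G k →
               IsLinearFunctional G (λ x → h x + k x)
    +-linear h-lin k-lin = isLinear
      (λ {x} {y} x≈y → R.+-cong (H.⟦⟧-cong {x} {y} x≈y) (K.⟦⟧-cong {x} {y} x≈y))
      (λ x y → R.trans (R.+-cong (H.+ᴹ-homo x y) (K.+ᴹ-homo x y)) (+-interchange _ _ _ _))
      (λ t x → R.trans (R.+-cong (H.*ₗ-homo t x) (K.*ₗ-homo t x)) (R.sym (R.distribˡ t _ _)))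
      where
      module H = IsLeftModuleHomomorphism h-lin
      module K = IsLeftModuleHomomorphism k-lin

    -‿linear : ∀ {h} → IsLinearFunctional G h → IsLinearFunctional G (λ x → - h x)
    -‿linear h-lin = isLinear
      (λ {x} {y} x≈y → R.-‿cong (H.⟦⟧-cong {x} {y} x≈y))
      (λ x y → R.trans (R.-‿cong (H.+ᴹ-homo x y)) (R.sym (⁻¹-∙-comm _ _)))
      (λ t x → R.trans (R.-‿cong (H.*ₗ-homo t x)) (RP.-‿distribʳ-* t _))
      where module H = IsLeftModuleHomomorphism h-lin

    ·-linear : ∀ n {h} → IsLinearFunctional G h → IsLinearFunctional G (λ x → n ·ᴿ h x)
    ·-linear zero    h-lin = 0-linear
    ·-linear (suc n) h-lin = +-linear h-lin (·-linear n h-lin)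

    ∑-linear : ∀ {n} {h : Fin n → Point G → R.Carrier} → (∀ k → IsLinearFunctional G (h k)) →
               IsLinearFunctional G (λ x → ∑ λ k → h k x)
    ∑-linear {zero}  h-lin = 0-linear
    ∑-linear {suc n} h-lin = +-linear (h-lin Fin.zero) (∑-linear λ k → h-lin (Fin.suc k))

    module _ (H : Subgroup G p) where
      restrict : Point G → Point ⟨ H ⟩
      restrict x = record
        { coord      = λ a → coord x (proj₁ a)
        ; coord-cong = coord-cong x
        ; coord-ε    = coord-ε x
        }

      restrict-cone : ∀ {x} → Cone G x → Cone ⟨ H ⟩ (restrict x)
      restrict-cone C = record
        { nonneg   = λ a → nonneg C (proj₁ a)
        ; triangle = λ a b → triangle C (proj₁ a) (proj₁ b)
        }

      restrict-linear : ∀ {h} → IsLinearFunctional ⟨ H ⟩ h → IsLinearFunctional G (λ x → h (restrict x))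
      restrict-linear h-lin = isLinear
        (λ {x} {y} x≈y → ⟦⟧-cong {restrict x} {restrict y} (λ a → x≈y (proj₁ a)))
        (λ x y → +ᴹ-homo (restrict x) (restrict y))
        (λ t x → *ₗ-homo t (restrict x))
        where open IsLeftModuleHomomorphism h-lin

-- Points of the form t s + Φ(w), and the excess functionals.

module MonoscopicProperties {c ℓ₁ ℓ₂ ℓ₃ : Level} (ℝ : Reals c ℓ₁ ℓ₂ ℓ₃)
                            {G : AbelianGroup g ℓ} (H : Subgroup G p) {β : ℕ}
                            (ord : HasOrder (G / H) β)
                            {ρ : AbelianGroup.Carrier G} (gen : IsGenerator (G / H) ρ) where
  open GroupCone ℝ
  open OrderedField ℝ
  open Decomposition H ord gen
  open DecompositionProperties H ord gen
  open Monoscopic H ord gen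
  open ConeProperties ℝ
  private
    module R = Reals ℝ
    module G = AbelianGroup G
    module H = AbelianGroup ⟨ H ⟩
    module RM = Mult R.+-commutativeMonoid
    module RP = AbelianGroupProperties R.+-abelianGroup
    module 𝔾 = LeftModule (space G)
    module ℍ = LeftModule (space ⟨ H ⟩)
  open R using (_+_; _*_; -_; _-_; 0#; 1#; _≈_; _≤_) renaming (_·_ to infixr 8 _·ᴿ_)
  open G using (_∙_)
  open Point
  open Cone
  open Mult G.commutativeMonoid using () renaming (_×_ to _·_)
  open SemiringMult R.semiring using (×-comm-*; ×-assoc-*)
  open Relation.Binary.Reasoning.PartialOrder R.≤-poset

  βρ : H.Carrier
  βρ = β · ρ , βρ∈H

  -- The points t s + Φ(w), with u standing for t + w_{βρ}.
  record Slope (x : Point G) (w : Point ⟨ H ⟩) (u : R.Carrier) : Set (g ⊔ ℓ₁) where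
    field at : ∀ i → coord x i ≈ β ·ᴿ coord w (rem i) + coef i ·ᴿ u

  open Slope

  betaRay-slope : Slope betaRay ℍ.0ᴹ 1#
  betaRay-slope = record { at = λ i → R.sym (R.trans (R.+-congʳ (·-zeroʳ β)) (R.+-identityˡ _)) }

  embedding-slope : ∀ w → Slope (embedding w) w (coord w βρ)
  embedding-slope w = record { at = λ i → R.refl }

  collect : ∀ a b m n u → (β ·ᴿ a + m ·ᴿ u) + (β ·ᴿ b + n ·ᴿ u) ≈ β ·ᴿ (a + b) + (m ℕ.+ n) ·ᴿ u
  collect a b m n u = R.trans (+-interchange _ _ _ _)
    (R.sym (R.+-cong (RM.×-distrib-+ a b β) (RM.×-homo-+ u m n)))

  slope-∈H : ∀ {x w u} → Slope x w u → ∀ a → coord x (proj₁ a) ≈ β ·ᴿ coord w a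
  slope-∈H {x} {w} {u} slope a = begin-equality
    coord x (proj₁ a)                                             ≈⟨ at slope (proj₁ a) ⟩
    β ·ᴿ coord w (rem (proj₁ a)) + coef (proj₁ a) ·ᴿ u            ≈⟨ R.+-cong
      (RM.×-congʳ β (coord-cong w (proj₂ (decompose-member a)))) (RM.×-congˡ (proj₁ (decompose-member a))) ⟩
    β ·ᴿ coord w a + 0#                                           ≈⟨ R.+-identityʳ _ ⟩
    β ·ᴿ coord w a                                                ∎

  -- The factor `coef i` covers `β = 1`, where `ρ` lies in H and its coordinate need not be `u`, but
  -- every coefficient is 0. A nonzero coefficient forces `1 < β`; then `ρ` has remainder 0 and
  -- coefficient 1, so its coordinate is `u`.
  slope-coef : ∀ {x w u} → Slope x w u → ∀ i → coef i ·ᴿ coord x ρ ≈ coef i ·ᴿ u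
  slope-coef {x} {w} {u} slope i with coef i | coef<β i
  ... | zero  | _    = R.refl
  ... | suc n | n<β = RM.×-congʳ (suc n) (begin-equality
    coord x ρ                                  ≈⟨ at slope ρ ⟩
    β ·ᴿ coord w (rem ρ) + coef ρ ·ᴿ u         ≈⟨ R.+-cong
      (RM.×-congʳ β (R.trans (coord-cong w (proj₂ ρ-parts)) (coord-ε w))) (RM.×-congˡ (proj₁ ρ-parts)) ⟩
    β ·ᴿ 0# + 1 ·ᴿ u                           ≈⟨ R.+-cong (·-zeroʳ β) (RM.×-homo-1 u) ⟩
    0# + u                                     ≈⟨ R.+-identityˡ u ⟩
    u                                          ∎)
    where ρ-parts = decompose-ρ (ℕ.≤-<-trans (ℕ.s≤s ℕ.z≤n) n<β)

  slope-cone : ∀ {x w u} → Cone ⟨ H ⟩ w → coord w βρ ≤ u → Slope x w u → Cone G x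
  slope-cone {x} {w} {u} C w≤u slope = record
    { nonneg = λ i → R.≤-trans
        (+-nonneg (·-nonneg β (nonneg C (rem i))) (·-nonneg (coef i) (R.≤-trans (nonneg C βρ) w≤u)))
        (R.≤-reflexive (R.sym (at slope i)))
    ; triangle = λ i j _ _ _ → (begin
        coord x (i ∙ j)                                                       ≈⟨ at slope (i ∙ j) ⟩
        β ·ᴿ coord w (rem (i ∙ j)) + coef (i ∙ j) ·ᴿ u                        ≤⟨ bound i j (decompose-∙ i j) ⟩
        β ·ᴿ (coord w (rem i) + coord w (rem j)) + (coef i ℕ.+ coef j) ·ᴿ u   ≈⟨ collect _ _ (coef i) (coef j) u ⟨
        (β ·ᴿ coord w (rem i) + coef i ·ᴿ u) + (β ·ᴿ coord w (rem j) + coef j ·ᴿ u)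
          ≈⟨ R.+-cong (at slope i) (at slope j) ⟨
        coord x i + coord x j                                                 ∎)
    }
    where
    w-subadditive : ∀ a b → coord w (a H.∙ b) ≤ coord w a + coord w b
    w-subadditive = subadditive ⟨ H ⟩ C
    bound : ∀ i j → _ → β ·ᴿ coord w (rem (i ∙ j)) + coef (i ∙ j) ·ᴿ u ≤
            β ·ᴿ (coord w (rem i) + coord w (rem j)) + (coef i ℕ.+ coef j) ·ᴿ u
    bound i j (inj₁ (c≡ , r≈)) = R.+-mono-≤
      (·-mono-≤ β (R.≤-trans (R.≤-reflexive (coord-cong w r≈)) (w-subadditive (rem i) (rem j))))
      (R.≤-reflexive (RM.×-congˡ c≡))
    -- The carry adds `βρ` to the remainder, costing at most `β` times `w_{βρ}`, hence at most
    -- `β ·ᴿ u`. This is exactly what the coefficient term loses when the coefficient drops by `β`.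
    bound i j (inj₂ (c≡ , r≈)) = begin
      β ·ᴿ coord w (rem (i ∙ j)) + k ·ᴿ u                                 ≈⟨ R.+-congʳ (RM.×-congʳ β (coord-cong w r≈)) ⟩
      β ·ᴿ coord w ((rem i H.∙ rem j) H.∙ βρ) + k ·ᴿ u                    ≤⟨ R.+-monoˡ-≤ _ (·-mono-≤ β (R.≤-trans
        (w-subadditive (rem i H.∙ rem j) βρ) (R.+-mono-≤ (w-subadditive (rem i) (rem j)) w≤u))) ⟩
      β ·ᴿ (coord w (rem i) + coord w (rem j) + u) + k ·ᴿ u               ≈⟨ R.+-congʳ (RM.×-distrib-+ _ u β) ⟩
      β ·ᴿ (coord w (rem i) + coord w (rem j)) + β ·ᴿ u + k ·ᴿ u          ≈⟨ R.+-assoc _ _ _ ⟩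
      β ·ᴿ (coord w (rem i) + coord w (rem j)) + (β ·ᴿ u + k ·ᴿ u)        ≈⟨ R.+-congˡ (RM.×-homo-+ u β k) ⟨
      β ·ᴿ (coord w (rem i) + coord w (rem j)) + (β ℕ.+ k) ·ᴿ u           ≈⟨ R.+-congˡ (RM.×-congˡ c≡) ⟩
      β ·ᴿ (coord w (rem i) + coord w (rem j)) + (coef i ℕ.+ coef j) ·ᴿ u ∎
      where k = coef (i ∙ j)

  private
    ray-coord : ∀ t w i → coord ((t 𝔾.*ₗ betaRay) 𝔾.+ᴹ embedding w) i ≈
                β ·ᴿ coord w (rem i) + coef i ·ᴿ (t + coord w βρ)
    ray-coord t w i = begin-equality
      t * (n ·ᴿ 1#) + (a + n ·ᴿ v)   ≈⟨ R.+-congʳ (×-comm-* n t 1#) ⟩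
      n ·ᴿ (t * 1#) + (a + n ·ᴿ v)   ≈⟨ R.+-congʳ (RM.×-congʳ n (R.*-identityʳ t)) ⟩
      n ·ᴿ t + (a + n ·ᴿ v)          ≈⟨ R.+-comm _ _ ⟩
      a + n ·ᴿ v + n ·ᴿ t            ≈⟨ R.+-assoc _ _ _ ⟩
      a + (n ·ᴿ v + n ·ᴿ t)          ≈⟨ R.+-congˡ (R.+-comm _ _) ⟩
      a + (n ·ᴿ t + n ·ᴿ v)          ≈⟨ R.+-congˡ (RM.×-distrib-+ t v n) ⟨
      a + n ·ᴿ (t + v)               ∎
      where
      n = coef i
      a = β ·ᴿ coord w (rem i)
      v = coord w βρ

  module _ (F : Pred (Point ⟨ H ⟩) f) where
    extension⇒slope : ∀ {x} → Extension F x → ∃₂ λ w u → F w × coord w βρ ≤ u × Slope x w u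
    extension⇒slope (t , w , 0≤t , w∈F , x≈) = w , t + coord w βρ , w∈F
      , (begin
          coord w βρ        ≈⟨ R.+-identityˡ _ ⟨
          0# + coord w βρ   ≤⟨ R.+-monoˡ-≤ _ 0≤t ⟩
          t + coord w βρ    ∎)
      , record { at = λ i → R.trans (x≈ i) (ray-coord t w i) }

    slope⇒extension : ∀ {x w u} → F w → coord w βρ ≤ u → Slope x w u → Extension F x
    slope⇒extension {x} {w} {u} w∈F w≤u slope =
      u - coord w βρ , w , ≤-difference w≤u , w∈F ,
      λ i → R.trans (at slope i) (R.sym (R.trans (ray-coord (u - coord w βρ) w i)
        (R.+-congˡ (RM.×-congʳ (coef i) (RP.//-rightDividesˡ (coord w βρ) u)))))

  -- The slack at `i = a + bρ` in the inequality between `x_i` and `x_a + b x_ρ`. If it vanishes at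
  -- every `i`, then `x` is determined by its restriction to H and its coordinate at `ρ`.
  excess : G.Carrier → Point G → R.Carrier
  excess i x = coord x (proj₁ (rem i)) + coef i ·ᴿ coord x ρ - coord x i

  excess-linear : ∀ i → IsLinearFunctional G (excess i)
  excess-linear i = +-linear G
    (+-linear G (coord-linear G (proj₁ (rem i))) (·-linear G (coef i) (coord-linear G ρ)))
    (-‿linear G (coord-linear G i))

  -- The total excess runs over the listed elements `from k`; this carries vanishing from
  -- `from (to i)` to an arbitrary `i`.
  excess-cong : ∀ x {i j} → i G.≈ j → excess i x ≈ excess j x
  excess-cong x i≈j = R.+-cong
    (R.+-cong (coord-cong x (rem-cong i≈j)) (RM.×-congˡ (coef-≈ i≈j)))
    (R.-‿cong (coord-cong x i≈j))

  excess-nonneg : ∀ {x} → Cone G x → ∀ i → 0# ≤ excess i x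
  excess-nonneg {x} C i = ≤-difference (begin
    coord x i                                               ≈⟨ coord-cong x (decompose i) ⟩
    coord x (proj₁ (rem i) ∙ coef i · ρ)                    ≤⟨ subadditive G C (proj₁ (rem i)) (coef i · ρ) ⟩
    coord x (proj₁ (rem i)) + coord x (coef i · ρ)          ≤⟨ R.+-mono-≤ R.≤-refl (·-subadditive G C (coef i) ρ) ⟩
    coord x (proj₁ (rem i)) + coef i ·ᴿ coord x ρ           ∎)

  slope⇒excess≈0 : ∀ {x w u} → Slope x w u → ∀ i → excess i x ≈ 0#
  slope⇒excess≈0 slope i = RP.x≈y⇒x∙y⁻¹≈ε (R.trans
    (R.+-cong (slope-∈H slope (rem i)) (slope-coef slope i))
    (R.sym (at slope i)))

  -- The extension as an exposed face.

  module ExtendedFace {m : ℕ} (∣G∣≡m : HasOrder G m)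
                      {F : Pred (Point ⟨ H ⟩) f} (face : IsFace ⟨ H ⟩ F) where
    open IsFace face renaming (functional to φ)
    open IsLeftModuleHomomorphism linear using (⟦⟧-cong; *ₗ-homo; 0ᴹ-homo)
    open Inverse ∣G∣≡m using (to; from; strictlyInverseʳ)

    -- Each element of G has exactly one remainder and one coefficient, so summing over an
    -- enumeration of G is the double sum over `a` and `b`.
    totalExcess : Point G → R.Carrier
    totalExcess x = ∑ λ k → excess (from k) x

    totalExcess-nonneg : ∀ {x} → Cone G x → 0# ≤ totalExcess x
    totalExcess-nonneg C = ∑-nonneg λ k → excess-nonneg C (from k)

    φ-restrict-nonneg : ∀ {x} → Cone G x → 0# ≤ φ (restrict G H x)
    φ-restrict-nonneg C = supporting (restrict-cone G H C)

    extension⇒exposed : ∀ {x} → Extension F x → Cone G x × totalExcess x + φ (restrict G H x) ≈ 0#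
    extension⇒exposed {x} x∈ with extension⇒slope F {x} x∈
    ... | w , u , w∈F , w≤u , slope = slope-cone (proj₁ (proj₁ exposed w∈F)) w≤u slope , (begin-equality
      totalExcess x + φ (restrict G H x)   ≈⟨ R.+-cong
        (∑-zero λ k → slope⇒excess≈0 slope (from k))
        -- On H the point is `β ·ᴿ w`. Writing this as the scalar `β ·ᴿ 1#` acting on `w` makes
        -- homogeneity of `φ` applicable.
        (⟦⟧-cong {restrict G H x} {(β ·ᴿ 1#) ℍ.*ₗ w} (λ a → R.trans (slope-∈H slope a) (R.sym
          (R.trans (×-assoc-* β 1# (coord w a)) (RM.×-congʳ β (R.*-identityˡ _)))))) ⟩
      0# + φ ((β ·ᴿ 1#) ℍ.*ₗ w)            ≈⟨ R.+-identityˡ _ ⟩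
      φ ((β ·ᴿ 1#) ℍ.*ₗ w)                 ≈⟨ *ₗ-homo (β ·ᴿ 1#) w ⟩
      (β ·ᴿ 1#) * φ w                      ≈⟨ R.*-congˡ (proj₂ (proj₁ exposed w∈F)) ⟩
      (β ·ᴿ 1#) * 0#                       ≈⟨ R.zeroʳ _ ⟩
      0#                                   ∎)

    exposed⇒extension : ∀ {x} → Cone G x × totalExcess x + φ (restrict G H x) ≈ 0# → Extension F x
    exposed⇒extension {x} (C , ψ≈0) = slope⇒extension F {x}
      (proj₂ exposed (w∈Cone , R.trans (*ₗ-homo y (restrict G H x)) (R.trans (R.*-congˡ (proj₂ zeros)) (R.zeroʳ y))))
      -- The slope is taken to be `x_ρ`. After multiplication by `β`, the bound `w_{βρ} ≤ u` reads
      -- `x_{βρ} ≤ β x_ρ`, which is repeated subadditivity.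
      (·-cancel-≤ β (R.≤-trans (R.≤-reflexive (βw≈x βρ)) (·-subadditive G C β ρ)))
      (record { at = λ i →
        R.trans (R.sym (RP.x∙y⁻¹≈ε⇒x≈y _ _ (excess≈0 i))) (R.+-congʳ (R.sym (βw≈x (rem i)))) })
      where
      -- Restricting t s + Φ(w) to H gives `β` times `w`, so `w` has to be the restriction of `x`
      -- divided by `β`.
      y = proj₁ (reciprocal β)
      w = y ℍ.*ₗ restrict G H x
      βw≈x : ∀ a → β ·ᴿ coord w a ≈ coord x (proj₁ a)
      βw≈x a = proj₂ (reciprocal β) (coord x (proj₁ a))
      zeros = nonneg-sum-zero (totalExcess-nonneg C) (φ-restrict-nonneg C) ψ≈0
      excess≈0 : ∀ i → excess i x ≈ 0#
      excess≈0 i = R.trans (excess-cong x (G.sym (strictlyInverseʳ i)))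
        (∑-zero⁻¹ (λ k → excess-nonneg C (from k)) (proj₁ zeros) (to i))
      -- Each inequality for `w` becomes, after multiplication by `β`, one that holds for `x`.
      w∈Cone : Cone ⟨ H ⟩ w
      w∈Cone = record
        { nonneg   = λ a → ·-cancel-≤ β (begin
            β ·ᴿ 0#             ≈⟨ ·-zeroʳ β ⟩
            0#                  ≤⟨ nonneg C (proj₁ a) ⟩
            coord x (proj₁ a)   ≈⟨ βw≈x a ⟨
            β ·ᴿ coord w a      ∎)
        ; triangle = λ a b _ _ _ → ·-cancel-≤ β (begin
            β ·ᴿ coord w (a H.∙ b)                  ≈⟨ βw≈x (a H.∙ b) ⟩
            coord x (proj₁ a ∙ proj₁ b)             ≤⟨ subadditive G C (proj₁ a) (proj₁ b) ⟩
            coord x (proj₁ a) + coord x (proj₁ b)   ≈⟨ R.+-cong (βw≈x a) (βw≈x b) ⟨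
            β ·ᴿ coord w a + β ·ᴿ coord w b         ≈⟨ RM.×-distrib-+ _ _ β ⟨
            β ·ᴿ (coord w a + coord w b)            ∎)
        }

    extensionFace : IsFace G (Extension F)
    extensionFace = record
      { functional = λ x → totalExcess x + φ (restrict G H x)
      ; linear     = +-linear G (∑-linear G λ k → excess-linear (from k)) (restrict-linear G H linear)
      ; supporting = λ C → +-nonneg (totalExcess-nonneg C) (φ-restrict-nonneg C)
      ; exposed    = extension⇒exposed , exposed⇒extension
      }

    -- The apex lies on every face because a linear functional vanishes there. Taking `w = 0` and
    -- slope 1 then makes the beta ray a point of the extension.
    0ᴹ∈F : F ℍ.0ᴹ
    0ᴹ∈F = proj₂ exposed (0ᴹ∈Cone ⟨ H ⟩ , 0ᴹ-homo)

    betaRay∈ : Extension F betaRay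
    betaRay∈ = slope⇒extension F 0ᴹ∈F (λ lt → R.<-irrefl R.refl (R.<-trans lt 0<1)) betaRay-slope

    embedding∈ : ∀ {w} → F w → Extension F (embedding w)
    embedding∈ {w} w∈F = slope⇒extension F w∈F R.≤-refl (embedding-slope w)

    -- The Kunz poset of the extended face.

    module _ (torsionG : Torsion G) (torsionH : Torsion ⟨ H ⟩) where
      private
        module P = QuotientPoset (Kunz.kunzPoset torsionH face)
        module Q = QuotientPoset (Kunz.kunzPoset torsionG extensionFace)

      -- The beta ray and the embedded points suffice as tests. Vanishing on the beta ray makes the
      -- coefficient of `i` zero, so `i` lies in H; there an embedded point is `β` times `w`, and
      -- `β` cancels.
      kunzSubgroup⇒ : ∀ {i} → Subgroup.member Q.subgroup i → Subgroup.member (lift P.subgroup) i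
      kunzSubgroup⇒ {i} v = i∈H , λ {w} w∈F → ·-cancel-≈ β (begin-equality
          β ·ᴿ coord w (i , i∈H)   ≈⟨ slope-∈H (embedding-slope w) (i , i∈H) ⟨
          coord (embedding w) i    ≈⟨ v {embedding w} (embedding∈ w∈F) ⟩
          0#                       ≈⟨ ·-zeroʳ β ⟨
          β ·ᴿ 0#                  ∎)
        where
        i∈H : Subgroup.member H i
        i∈H = Subgroup.resp H (coef≡0⇒rem≈ (·1-injective (coef i) 0 (v {betaRay} betaRay∈))) (proj₂ (rem i))

      -- On H every point of the extension is `β` times some `w` in `F`, whatever its slope.
      kunzSubgroup⇐ : ∀ {i} → Subgroup.member (lift P.subgroup) i → Subgroup.member Q.subgroup i
      kunzSubgroup⇐ {i} (i∈H , v) {x} x∈ with extension⇒slope F {x} x∈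
      ... | w , u , w∈F , _ , slope = R.trans (slope-∈H slope (i , i∈H))
        (R.trans (RM.×-congʳ β (v w∈F)) (·-zeroʳ β))

      -- The beta ray shows that the coefficients of `i` and `j - i` add up to that of `j`, so the
      -- subtraction has no borrow. At an embedded point the coefficient terms on both sides then
      -- agree and cancel, leaving `β` times the relation between the remainders.
      kunzOrder⇒ : ∀ {i j} → i Q.⪯ j → rem i P.⪯ rem j × coef i ℕ.≤ coef j
      kunzOrder⇒ {i} {j} i⪯j = (λ {w} w∈F → ·-cancel-≈ β (RP.∙-cancelʳ (coef j ·ᴿ coord w βρ) _ _ (begin-equality
          β ·ᴿ (coord w (rem i) + coord w (rem j H.- rem i)) + coef j ·ᴿ coord w βρ  ≈⟨ R.+-cong
            (RM.×-congʳ β (R.+-congˡ (coord-cong w (proj₂ (decompose-difference {i} {j} ci≤cj))))) (RM.×-congˡ coef-+) ⟨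
          β ·ᴿ (coord w (rem i) + coord w (rem (j G.- i))) + (coef i ℕ.+ coef (j G.- i)) ·ᴿ coord w βρ
            ≈⟨ collect _ _ (coef i) _ _ ⟨
          coord (embedding w) i + coord (embedding w) (j G.- i)   ≈⟨ i⪯j {embedding w} (embedding∈ w∈F) ⟩
          coord (embedding w) j                                   ∎)))
        , ci≤cj
        where
        coef-+ : coef i ℕ.+ coef (j G.- i) ≡ coef j
        coef-+ = ·1-injective _ _ (R.trans (RM.×-homo-+ 1# (coef i) _) (i⪯j {betaRay} betaRay∈))
        ci≤cj : coef i ℕ.≤ coef j
        ci≤cj = ℕ.m+n≤o⇒m≤o (coef i) (ℕ.≤-reflexive coef-+)

      -- The inequality of coefficients rules out a borrow, so for any slope `u` the coefficient
      -- terms add up to those of `j`, and the relation in `P` settles the remainders.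
      kunzOrder⇐ : ∀ {i j} → rem i P.⪯ rem j × coef i ℕ.≤ coef j → i Q.⪯ j
      kunzOrder⇐ {i} {j} (ri⪯rj , ci≤cj) {x} x∈ with extension⇒slope F {x} x∈
      ... | w , u , w∈F , _ , slope = begin-equality
        coord x i + coord x (j G.- i)                             ≈⟨ R.+-cong (at slope i) (at slope (j G.- i)) ⟩
        (β ·ᴿ coord w (rem i) + coef i ·ᴿ u) + (β ·ᴿ coord w (rem (j G.- i)) + coef (j G.- i) ·ᴿ u)
          ≈⟨ collect _ _ (coef i) _ u ⟩
        β ·ᴿ (coord w (rem i) + coord w (rem (j G.- i))) + (coef i ℕ.+ coef (j G.- i)) ·ᴿ u ≈⟨ R.+-cong
          (RM.×-congʳ β (R.+-congˡ (coord-cong w (proj₂ d))))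
          (RM.×-congˡ (≡.trans (≡.cong (coef i ℕ.+_) (proj₁ d)) (ℕ.m+[n∸m]≡n ci≤cj))) ⟩
        β ·ᴿ (coord w (rem i) + coord w (rem j H.- rem i)) + coef j ·ᴿ u   ≈⟨ R.+-congʳ (RM.×-congʳ β (ri⪯rj w∈F)) ⟩
        β ·ᴿ coord w (rem j) + coef j ·ᴿ u                        ≈⟨ at slope j ⟨
        coord x j                                                 ∎
        where d = decompose-difference {i} {j} ci≤cj

theorem6p10 :
    ∀ {c ℓ₁ ℓ₂ ℓ₃ g ℓ p f : Level} (ℝ : Reals c ℓ₁ ℓ₂ ℓ₃) →
    let open GroupCone ℝ in
    (G : AbelianGroup g ℓ) {m : ℕ} (∣G∣≡m : HasOrder G m)
    (H : Subgroup G p) {β : ℕ} (∣G/H∣≡β : HasOrder (G / H) β)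
    (ρ : AbelianGroup.Carrier G) (ρ-generates : IsGenerator (G / H) ρ) →
    let open Decomposition H ∣G/H∣≡β ρ-generates using (monoscopicExtension)
        open Monoscopic H ∣G/H∣≡β ρ-generates using (Extension)
        torsionG = FiniteGroup.torsion G ∣G∣≡m
        torsionH = ⟨⟩-torsion H torsionG
    in
    (F : Pred (Point ⟨ H ⟩) f) (face : IsFace ⟨ H ⟩ F) →
    Σ (IsFace G (Extension F)) λ face⁺ →
      SamePoset (Kunz.kunzPoset torsionG face⁺)
                (monoscopicExtension (Kunz.kunzPoset torsionH face))
theorem6p10 ℝ G ∣G∣≡m H ∣G/H∣≡β ρ ρ-generates F face =
  extensionFace ,
  (kunzSubgroup⇒ torsionG torsionH , kunzSubgroup⇐ torsionG torsionH) ,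
  (λ {i} {j} → kunzOrder⇒ torsionG torsionH {i} {j}) , (λ {i} {j} → kunzOrder⇐ torsionG torsionH {i} {j})
  where
  open MonoscopicProperties.ExtendedFace ℝ H ∣G/H∣≡β ρ-generates ∣G∣≡m face
  torsionG = FiniteGroup.torsion G ∣G∣≡m
  torsionH = ⟨⟩-torsion H torsionG
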